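{- If $G$ is a connected graph with $n$ vertices and $k>0$ basis forced vertices, then $k\leq n-\dim(G)-1$. Moreover, $k\leq \frac{n-1}{2}$.
   Context: All graphs are finite and simple. For vertices $u,v$ of a connected graph $G$, $d(u,v)$ is the length of a shortest $u$–$v$ path. A set $R\subseteq V(G)$ is a resolving set if for all distinct $x,y\in V(G)$ there is $r\in R$ with $d(r,x)\neq d(r,y)$. The metric dimension $\dim(G)$ is the minimum cardinality of a resolving set, and a resolving set of cardinality $\dim(G)$ is a metric basis. A vertex is a basis forced vertex if it belongs to every metric basis of $G$. -}

module Defs where

open import Data.Fin using (Fin)
open import Data.Fin.Properties using (_≟_; any?; all?)
open import Data.Fin.Subset using (Subset; _∈_; ⊤; ∣_∣)
open import Data.Fin.Subset.Properties using (_∈?_; anySubset?; ∈⊤)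
open import Data.List using (List; []; _∷_; length; filter; allFin)
open import Data.List.Relation.Unary.Unique.Propositional using (Unique)
open import Data.Nat using (ℕ; zero; suc; _≤_; z≤n; s≤s)
import Data.Nat.Properties as ℕ
open import Data.Product using (Σ; ∃; _×_; _,_; proj₁; proj₂)
open import Level using (0ℓ)
open import Relation.Binary using (Rel; Symmetric; Irreflexive) renaming (Decidable to Decidable₂)
open import Relation.Binary.PropositionalEquality using (_≡_; _≢_; refl; sym; trans; subst)
open import Relation.Nullary using (Dec; yes; no; contradiction)
open import Relation.Nullary.Decidable using (map′; ¬?; _×-dec_; _→-dec_; decidable-stable)
open import Relation.Unary using (Pred; Decidable)

import Data.List.Relation.Unary.Unique.DecPropositional as UniqueDec

IsLeast : Pred ℕ 0ℓ → ℕ → Set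
IsLeast P m = P m × (∀ k → P k → m ≤ k)

least : (P : Pred ℕ 0ℓ) → Decidable P → ∀ k → P k → ∃ (IsLeast P)
least P P? zero p = 0 , p , λ _ _ → z≤n
least P P? (suc k) p with P? 0
... | yes p₀ = 0 , p₀ , λ _ _ → z≤n
... | no ¬p₀ with least (λ i → P (suc i)) (λ i → P? (suc i)) k p
...   | m , pₘ , m≤ = suc m , pₘ , λ where
          zero    q → contradiction q ¬p₀
          (suc i) q → s≤s (m≤ i q)

-- Finite simple graphs with n vertices. Decidable adjacency is automatic
-- classically and makes distances and metric dimension computable.
record Graph (n : ℕ) : Set₁ where
  infix 4 _~_ _~?_
  field
    _~_      : Rel (Fin n) 0ℓ
    _~?_     : Decidable₂ _~_
    ~-sym    : Symmetric _~_
    ~-irrefl : Irreflexive _≡_ _~_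

module _ {n : ℕ} (G : Graph n) where

  open Graph G

  -- Indexed by the endpoints and the number of edges.
  data Walk : Fin n → Fin n → ℕ → Set where
    nil  : ∀ {u} → Walk u u 0
    cons : ∀ {u w v ℓ} → u ~ w → Walk w v ℓ → Walk u v (suc ℓ)

  vertices : ∀ {u v ℓ} → Walk u v ℓ → List (Fin n)
  vertices {u} nil        = u ∷ []
  vertices {u} (cons _ p) = u ∷ vertices p

  Path : Fin n → Fin n → ℕ → Set
  Path u v ℓ = Σ (Walk u v ℓ) λ p → Unique (vertices p)

  Connected : Set
  Connected = ∀ u v → ∃ (Path u v)

  walk? : (P : Pred (List (Fin n)) 0ℓ) → Decidable P →
          ∀ u v ℓ → Dec (Σ (Walk u v ℓ) λ p → P (vertices p))
  walk? P P? u v zero with u ≟ v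
  ... | no u≢v = no λ { (nil , _) → u≢v refl }
  ... | yes refl = map′ (nil ,_) (λ { (nil , q) → q }) (P? (u ∷ []))
  walk? P P? u v (suc ℓ) =
    map′ (λ { (_ , e , p , q) → cons e p , q })
         (λ { (cons e p , q) → _ , e , p , q })
         (any? λ w → (u ~? w) ×-dec walk? (λ xs → P (u ∷ xs)) (λ xs → P? (u ∷ xs)) w v ℓ)

  path? : ∀ u v → Decidable (Path u v)
  path? = walk? Unique (UniqueDec.unique? _≟_)

module _ {n : ℕ} (G : Graph n) (conn : Connected G) where

  dist-least : ∀ u v → ∃ (IsLeast (Path G u v))
  dist-least u v = least (Path G u v) (path? G u v) (proj₁ (conn u v)) (proj₂ (conn u v))

  dist : Fin n → Fin n → ℕ
  dist u v = proj₁ (dist-least u v)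

  Resolving : Pred (Subset n) 0ℓ
  Resolving R = ∀ x y → x ≢ y → ∃ λ r → r ∈ R × dist r x ≢ dist r y

  resolving? : Decidable Resolving
  resolving? R = all? λ x → all? λ y → ¬? (x ≟ y) →-dec
    any? λ r → (r ∈? R) ×-dec ¬? (dist r x ℕ.≟ dist r y)

  dist-refl : ∀ u → dist u u ≡ 0
  dist-refl u = ℕ.n≤0⇒n≡0 (proj₂ (proj₂ (dist-least u u)) 0 (nil , [] ∷ []))
    where open import Data.List.Relation.Unary.AllPairs using ([]; _∷_)
          open import Data.List.Relation.Unary.All using ([])

  dist≡0⇒≡ : ∀ {u v} → dist u v ≡ 0 → u ≡ v
  dist≡0⇒≡ {u} {v} eq with subst (Path G u v) eq (proj₁ (proj₂ (dist-least u v)))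
  ... | nil , _ = refl

  ⊤-resolving : Resolving ⊤
  ⊤-resolving x y x≢y =
    x , ∈⊤ , λ eq → x≢y (dist≡0⇒≡ (trans (sym eq) (dist-refl x)))

  HasResolvingSetOfSize : Pred ℕ 0ℓ
  HasResolvingSetOfSize k = ∃ λ R → Resolving R × ∣ R ∣ ≡ k

  dim-least : ∃ (IsLeast HasResolvingSetOfSize)
  dim-least = least HasResolvingSetOfSize
    (λ k → anySubset? λ R → resolving? R ×-dec (∣ R ∣ ℕ.≟ k))
    ∣ ⊤ {n} ∣ (⊤ , ⊤-resolving , refl)

  dim : ℕ
  dim = proj₁ dim-least

  MetricBasis : Pred (Subset n) 0ℓ
  MetricBasis R = Resolving R × ∣ R ∣ ≡ dim

  metricBasis? : Decidable MetricBasis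
  metricBasis? R = resolving? R ×-dec (∣ R ∣ ℕ.≟ dim)

  BasisForced : Pred (Fin n) 0ℓ
  BasisForced v = ∀ R → MetricBasis R → v ∈ R

  basisForced? : Decidable BasisForced
  basisForced? v =
    map′ (λ ¬∃ R b → decidable-stable (v ∈? R) λ v∉R → ¬∃ (R , b , v∉R))
         (λ forced (R , b , v∉R) → v∉R (forced R b))
         (¬? (anySubset? λ R → metricBasis? R ×-dec ¬? (v ∈? R)))

  numBasisForced : ℕ
  numBasisForced = length (filter basisForced? (allFin n))

{-# OPTIONS --safe #-}

-- Let R be a metric basis. Every forced vertex f separates two vertices outside
-- R that no other element of R separates: otherwise the only pair left unresolved
-- by R − f would be {f, y} for some y ∉ R, and exchanging f for y would give a metric
-- basis avoiding f. Taking these pairs as edges on the complement of R gives a forest: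
-- around a cycle the distance to f would change only at the edge of f. So there are fewer
-- forced vertices than vertices outside R, and at most as many as vertices in R.
module Submission where

open import Defs
open import Data.Fin using (Fin; zero; suc)
open import Data.Fin.Properties using (_≟_; any?; all?)
open import Data.Fin.Subset using (Subset; inside; outside; _∈_; _∉_; _∪_; _-_; ∁; ⁅_⁆; ∣_∣; Nonempty)
open import Data.Fin.Subset.Properties
open import Data.List using (List; []; _∷_; length; filter; allFin)
open import Data.List.Membership.Propositional renaming (_∈_ to _∈ₗ_) using ()
open import Data.List.Membership.Propositional.Properties using (∈-filter⁻)
open import Data.List.Relation.Unary.All using (lookup)
open import Data.List.Relation.Unary.AllPairs using ([]; _∷_)
open import Data.List.Relation.Unary.Any using (here; there)
open import Data.List.Relation.Unary.Unique.Propositional using (Unique)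
open import Data.List.Relation.Unary.Unique.Propositional.Properties using (allFin⁺; filter⁺)
open import Data.Nat using (ℕ; suc; _+_; _*_; _∸_; _≤_; _<_; z≤n; s≤s)
import Data.Nat.Properties as ℕ
open import Data.Product using (∃; ∃₂; _×_; _,_; proj₁; proj₂)
open import Data.Sum using (inj₁; inj₂)
open import Data.Vec using ([]; _∷_; there)
open import Function using (_∘_)
open import Relation.Binary.PropositionalEquality using (_≡_; _≢_; refl; sym; trans; cong; subst; ≢-sym)
open import Relation.Nullary using (¬_; yes; no; contradiction)
open import Relation.Nullary.Decidable using (¬?; _×-dec_; _→-dec_; decidable-stable)

x∉p-x : ∀ {n} (p : Subset n) x → x ∉ p - x
x∉p-x (_ ∷ _) zero    ()
x∉p-x (_ ∷ p) (suc x) (there x∈) = x∉p-x p x x∈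

∣p∪q∣≤∣p∣+∣q∣ : ∀ {n} (p q : Subset n) → ∣ p ∪ q ∣ ≤ ∣ p ∣ + ∣ q ∣
∣p∪q∣≤∣p∣+∣q∣ []            []            = z≤n
∣p∪q∣≤∣p∣+∣q∣ (outside ∷ p) (outside ∷ q) = ∣p∪q∣≤∣p∣+∣q∣ p q
∣p∪q∣≤∣p∣+∣q∣ (outside ∷ p) (inside ∷ q)  =
  ℕ.≤-trans (s≤s (∣p∪q∣≤∣p∣+∣q∣ p q)) (ℕ.≤-reflexive (sym (ℕ.+-suc ∣ p ∣ ∣ q ∣)))
∣p∪q∣≤∣p∣+∣q∣ (inside ∷ p)  (outside ∷ q) = s≤s (∣p∪q∣≤∣p∣+∣q∣ p q)
∣p∪q∣≤∣p∣+∣q∣ (inside ∷ p)  (inside ∷ q)  =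
  s≤s (ℕ.≤-trans (∣p∪q∣≤∣p∣+∣q∣ p q) (ℕ.+-monoʳ-≤ _ (ℕ.n≤1+n _)))

∣p-x∪⁅y⁆∣≤∣p∣ : ∀ {n} {p : Subset n} {x} y → x ∈ p → ∣ (p - x) ∪ ⁅ y ⁆ ∣ ≤ ∣ p ∣
∣p-x∪⁅y⁆∣≤∣p∣ {p = p} {x} y x∈p = begin
  ∣ (p - x) ∪ ⁅ y ⁆ ∣     ≤⟨ ∣p∪q∣≤∣p∣+∣q∣ (p - x) ⁅ y ⁆ ⟩
  ∣ p - x ∣ + ∣ ⁅ y ⁆ ∣   ≡⟨ cong (∣ p - x ∣ +_) (∣⁅x⁆∣≡1 y) ⟩
  ∣ p - x ∣ + 1           ≡⟨ ℕ.+-comm _ 1 ⟩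
  suc ∣ p - x ∣           ≤⟨ x∈p⇒∣p-x∣<∣p∣ x∈p ⟩
  ∣ p ∣                   ∎
  where open ℕ.≤-Reasoning

Unique⇒length≤∣p∣ : ∀ {n} (p : Subset n) (xs : List (Fin n)) → Unique xs →
                    (∀ {x} → x ∈ₗ xs → x ∈ p) → length xs ≤ ∣ p ∣
Unique⇒length≤∣p∣ p []       _            _    = z≤n
Unique⇒length≤∣p∣ p (x ∷ xs) (x∉xs ∷ xs!) xs⊆p = ℕ.≤-<-trans
  (Unique⇒length≤∣p∣ (p - x) xs xs! λ y∈xs →
    x∈p∧x≢y⇒x∈p-y (xs⊆p (there y∈xs)) (≢-sym (lookup x∉xs y∈xs)))
  (x∈p⇒∣p-x∣<∣p∣ (xs⊆p (here refl)))

module _ {n : ℕ} {A B : Set} (d : A → Fin n → B) where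

  -- The competitors `Q` are a parameter because the exchange argument compares `f` with all of a
  -- metric basis, while the counting induction needs only a list that loses one function at each
  -- contraction.
  PrivatelySeparates : (A → Set) → Subset n → A → Set
  PrivatelySeparates Q S f = ∃₂ λ x y → x ∈ S × y ∈ S × d f x ≢ d f y ×
    (∀ g → Q g → g ≢ f → d g x ≡ d g y)

  -- The edge of the first function is contracted: x is removed and y takes its place
  -- in the remaining pairs, which the remaining functions cannot notice.
  privatelySeparates⇒length<∣S∣ : ∀ (S : Subset n) (fs : List A) → Unique fs → Nonempty S →
    (∀ {f} → f ∈ₗ fs → PrivatelySeparates (_∈ₗ fs) S f) → length fs < ∣ S ∣
  -- The strictness comes from here: when every edge has been contracted, a point of `S` is still
  -- left.
  privatelySeparates⇒length<∣S∣ S [] _ (_ , x∈S) _ = ℕ.≤-<-trans z≤n (x∈p⇒∣p-x∣<∣p∣ x∈S)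
  privatelySeparates⇒length<∣S∣ S (f ∷ fs) (f∉fs ∷ fs!) _ sep with sep (here refl)
  ... | x , y , x∈S , y∈S , fx≢fy , agree = ℕ.≤-<-trans
      (privatelySeparates⇒length<∣S∣ (S - x) fs fs! (y , y∈S-x) sep′) (x∈p⇒∣p-x∣<∣p∣ x∈S)
    where
    y∈S-x : y ∈ S - x
    y∈S-x = x∈p∧x≢y⇒x∈p-y y∈S λ y≡x → fx≢fy (cong (d f) (sym y≡x))

    contract : ∀ {z} → z ∈ S → ∃ λ z′ → z′ ∈ S - x × (∀ {g} → g ∈ₗ fs → d g z ≡ d g z′)
    contract {z} z∈S with z ≟ x
    ... | yes refl = y , y∈S-x , λ g∈fs → agree _ (there g∈fs) (≢-sym (lookup f∉fs g∈fs))
    ... | no z≢x   = z , x∈p∧x≢y⇒x∈p-y z∈S z≢x , λ _ → refl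

    sep′ : ∀ {g} → g ∈ₗ fs → PrivatelySeparates (_∈ₗ fs) (S - x) g
    sep′ {g} g∈fs with sep (there g∈fs)
    ... | u , v , u∈S , v∈S , gu≢gv , agree′ with contract u∈S | contract v∈S
    ... | u′ , u′∈ , u≈u′ | v′ , v′∈ , v≈v′ = u′ , v′ , u′∈ , v′∈ ,
      (λ eq → gu≢gv (trans (u≈u′ g∈fs) (trans eq (sym (v≈v′ g∈fs))))) ,
      λ h h∈fs h≢g → trans (sym (u≈u′ h∈fs)) (trans (agree′ h (there h∈fs) h≢g) (v≈v′ h∈fs))

module _ {n : ℕ} (G : Graph n) (conn : Connected G) where

  private
    d : Fin n → Fin n → ℕ
    d = dist G conn

  dim≤∣R∣ : ∀ {R} → Resolving G conn R → dim G conn ≤ ∣ R ∣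
  dim≤∣R∣ {R} res = proj₂ (proj₂ (dim-least G conn)) ∣ R ∣ (R , res , refl)

  dist-self-≢ : ∀ {x y} → x ≢ y → d x x ≢ d x y
  dist-self-≢ {x} x≢y eq = x≢y (dist≡0⇒≡ G conn (trans (sym eq) (dist-refl G conn x)))

  -- The pair is obtained constructively, since the search over the finitely many vertices is
  -- decidable.
  ¬resolving⇒unresolved : ∀ {R} → ¬ Resolving G conn R →
    ∃₂ λ x y → x ≢ y × (∀ r → r ∈ R → d r x ≡ d r y)
  ¬resolving⇒unresolved {R} ¬res = decidable-stable
    (any? λ x → any? λ y → ¬? (x ≟ y) ×-dec all? λ r → (r ∈? R) →-dec (d r x ℕ.≟ d r y))
    λ ¬pair → ¬res λ x y x≢y → decidable-stable
      (any? λ r → (r ∈? R) ×-dec ¬? (d r x ℕ.≟ d r y))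
      λ ¬r → ¬pair (x , y , x≢y , λ r r∈R → decidable-stable (d r x ℕ.≟ d r y)
        λ neq → ¬r (r , r∈R , neq))

  -- A vertex of `R` separates itself from every other vertex, being at distance 0 only from itself.
  unresolved⇒∉ˡ : ∀ {R x y} → x ≢ y → (∀ r → r ∈ R → d r x ≡ d r y) → x ∉ R
  unresolved⇒∉ˡ x≢y agree x∈R = dist-self-≢ x≢y (agree _ x∈R)

  unresolved⇒∉ʳ : ∀ {R x y} → x ≢ y → (∀ r → r ∈ R → d r x ≡ d r y) → y ∉ R
  unresolved⇒∉ʳ x≢y agree = unresolved⇒∉ˡ (≢-sym x≢y) λ r r∈R → sym (agree r r∈R)

  module _ {R : Subset n} (basis : MetricBasis G conn R)
           {f : Fin n} (forced : BasisForced G conn f) where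

    private
      f∈R : f ∈ R
      f∈R = forced R basis

      Unresolved : Fin n → Fin n → Set
      Unresolved x y = ∀ r → r ∈ R - f → d r x ≡ d r y

      unresolved-sym : ∀ {x y} → Unresolved x y → Unresolved y x
      unresolved-sym agree r r∈ = sym (agree r r∈)

      ∉R-f⇒∉R : ∀ {x} → x ≢ f → x ∉ R - f → x ∉ R
      ∉R-f⇒∉R x≢f x∉ x∈R = x∉ (x∈p∧x≢y⇒x∈p-y x∈R x≢f)

      -- The basis `R` resolves the pair and `R - f` does not, so the resolving vertex has to be
      -- `f`.
      outsidePair⇒separates : ∀ {x y} → x ≢ y → x ≢ f → y ≢ f → Unresolved x y →
                              PrivatelySeparates d (_∈ R) (∁ R) f
      outsidePair⇒separates {x} {y} x≢y x≢f y≢f agree =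
        x , y ,
        x∉p⇒x∈∁p (∉R-f⇒∉R x≢f (unresolved⇒∉ˡ x≢y agree)) ,
        x∉p⇒x∈∁p (∉R-f⇒∉R y≢f (unresolved⇒∉ʳ x≢y agree)) ,
        f-separates ,
        λ g g∈R g≢f → agree g (x∈p∧x≢y⇒x∈p-y g∈R g≢f)
        where
        f-separates : d f x ≢ d f y
        f-separates with proj₁ basis x y x≢y
        ... | r , r∈R , neq with r ≟ f
        ... | yes refl = neq
        ... | no r≢f   = contradiction (agree r (x∈p∧x≢y⇒x∈p-y r∈R r≢f)) neq

    removal-¬resolving : ¬ Resolving G conn (R - f)
    removal-¬resolving res = ℕ.<⇒≱ (x∈p⇒∣p-x∣<∣p∣ f∈R)
      (subst (_≤ ∣ R - f ∣) (sym (proj₂ basis)) (dim≤∣R∣ res))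

    exchange-¬resolving : ∀ {y} → f ≢ y → ¬ Resolving G conn ((R - f) ∪ ⁅ y ⁆)
    exchange-¬resolving {y} f≢y res = f∉R′ (forced R′ (res , ∣R′∣≡dim))
      where
      R′ : Subset n
      R′ = (R - f) ∪ ⁅ y ⁆

      -- The exchange only bounds the size from above, as `y` may already lie in `R - f`; minimality
      -- of the dimension gives the other inequality.
      ∣R′∣≡dim : ∣ R′ ∣ ≡ dim G conn
      ∣R′∣≡dim = ℕ.≤-antisym
        (subst (∣ R′ ∣ ≤_) (proj₂ basis) (∣p-x∪⁅y⁆∣≤∣p∣ y f∈R)) (dim≤∣R∣ res)

      f∉R′ : f ∉ R′
      f∉R′ f∈R′ with x∈p∪q⁻ (R - f) ⁅ y ⁆ f∈R′
      ... | inj₁ f∈R-f = x∉p-x R f f∈R-f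
      ... | inj₂ f∈⁅y⁆ = f≢y (x∈⁅y⁆⇒x≡y y f∈⁅y⁆)

    private
      -- A pair containing `f` is not outside `R`, so a second pair is taken, one that the exchanged
      -- set leaves unresolved. It avoids `y`, which belongs to that set.
      unresolvedWithForced : ∀ {y} → f ≢ y → Unresolved f y →
                             PrivatelySeparates d (_∈ R) (∁ R) f
      unresolvedWithForced {y} f≢y f≈y with ¬resolving⇒unresolved (exchange-¬resolving f≢y)
      ... | u , v , u≢v , agree with u ≟ f | v ≟ f
      -- Where the second pair contains `f`, the vertex `y` can stand in for it, because `R - f`
      -- does not tell the two apart.
      ... | yes refl | _ = outsidePair⇒separates (≢-sym y≢v) (≢-sym u≢v) (≢-sym f≢y)
              λ r r∈ → trans (sym (agree r (x∈p∪q⁺ (inj₁ r∈)))) (f≈y r r∈)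
        where
        y≢v : y ≢ v
        y≢v refl = unresolved⇒∉ʳ u≢v agree (x∈p∪q⁺ (inj₂ (x∈⁅x⁆ y)))
      ... | no _ | yes refl = outsidePair⇒separates (≢-sym y≢u) u≢v (≢-sym f≢y)
              λ r r∈ → trans (agree r (x∈p∪q⁺ (inj₁ r∈))) (f≈y r r∈)
        where
        y≢u : y ≢ u
        y≢u refl = unresolved⇒∉ˡ u≢v agree (x∈p∪q⁺ (inj₂ (x∈⁅x⁆ y)))
      ... | no u≢f | no v≢f = outsidePair⇒separates u≢v u≢f v≢f
              λ r r∈ → agree r (x∈p∪q⁺ (inj₁ r∈))

    forced⇒privatelySeparates : PrivatelySeparates d (_∈ R) (∁ R) f
    forced⇒privatelySeparates with ¬resolving⇒unresolved removal-¬resolving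
    ... | x , y , x≢y , agree with x ≟ f | y ≟ f
    ... | yes refl | _        = unresolvedWithForced x≢y agree
    ... | no _     | yes refl = unresolvedWithForced (≢-sym x≢y) (unresolved-sym agree)
    ... | no x≢f   | no y≢f   = outsidePair⇒separates x≢y x≢f y≢f agree

  forcedVertices : List (Fin n)
  forcedVertices = filter (basisForced? G conn) (allFin n)

  forcedVertices-unique : Unique forcedVertices
  forcedVertices-unique = filter⁺ (basisForced? G conn) (allFin⁺ n)

  ∈forcedVertices⇒forced : ∀ {f} → f ∈ₗ forcedVertices → BasisForced G conn f
  ∈forcedVertices⇒forced = proj₂ ∘ ∈-filter⁻ (basisForced? G conn) {xs = allFin n}

  private
    k : ℕ
    k = numBasisForced G conn

  numBasisForced≤∣basis∣ : ∀ {R} → MetricBasis G conn R → k ≤ ∣ R ∣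
  numBasisForced≤∣basis∣ {R} basis =
    Unique⇒length≤∣p∣ R forcedVertices forcedVertices-unique
      λ f∈ → ∈forcedVertices⇒forced f∈ R basis

  numBasisForced<∣∁basis∣ : ∀ {R} → MetricBasis G conn R → 0 < k → k < ∣ ∁ R ∣
  numBasisForced<∣∁basis∣ {R} basis 0<k =
    privatelySeparates⇒length<∣S∣ d (∁ R) forcedVertices forcedVertices-unique
      -- The pair of any one forced vertex already supplies a point outside `R`; this is where
      -- `0 < k` enters.
      (∁R-nonempty forcedVertices 0<k separates) separates
    where
    separates : ∀ {f} → f ∈ₗ forcedVertices →
                PrivatelySeparates d (_∈ₗ forcedVertices) (∁ R) f
    separates f∈ =
      let x , y , x∈ , y∈ , neq , agree =
            forced⇒privatelySeparates basis (∈forcedVertices⇒forced f∈)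
      -- Forced vertices lie in `R`, so privacy against `R` restricts to privacy against the other
      -- forced vertices.
      in  x , y , x∈ , y∈ , neq , λ g g∈ → agree g (∈forcedVertices⇒forced g∈ R basis)

    ∁R-nonempty : ∀ fs {Q : Fin n → Set} → 0 < length fs →
      (∀ {f} → f ∈ₗ fs → PrivatelySeparates d Q (∁ R) f) → Nonempty (∁ R)
    ∁R-nonempty (_ ∷ _) _ sep =
      let x , _ , x∈ , _ = sep (here refl) in x , x∈

  metricBasis-exists : ∃ (MetricBasis G conn)
  metricBasis-exists = proj₁ (proj₂ (dim-least G conn))

k<∣∁p∣⇒bounds : ∀ {n k m} (p : Subset n) → ∣ p ∣ ≡ m → k ≤ ∣ p ∣ → k < ∣ ∁ p ∣ →
                (k ≤ n ∸ m ∸ 1) × (2 * k ≤ n ∸ 1)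
k<∣∁p∣⇒bounds {n} {k} p refl k≤∣p∣ k<∣∁p∣ = ℕ.∸-monoˡ-≤ 1 k<n∸∣p∣ , (begin
  2 * k       ≡⟨ cong (k +_) (ℕ.+-identityʳ k) ⟩
  k + k       ≤⟨ ℕ.+-monoʳ-≤ k k≤∣p∣ ⟩
  -- The strict bound reads `suc k + ∣ p ∣ ≤ n`, and its successor pays for the 1 subtracted from
  -- `n`.
  k + ∣ p ∣   ≤⟨ ℕ.∸-monoˡ-≤ 1 (ℕ.m≤o∸n⇒m+n≤o (suc k) (∣p∣≤n p) k<n∸∣p∣) ⟩
  n ∸ 1       ∎)
  where
  open ℕ.≤-Reasoning

  k<n∸∣p∣ : k < n ∸ ∣ p ∣
  k<n∸∣p∣ = subst (k <_) (∣∁p∣≡n∸∣p∣ p) k<∣∁p∣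

theorem8 : (n : ℕ) (G : Graph n) (conn : Connected G) (k : ℕ) →
    numBasisForced G conn ≡ k → 0 < k →
    (k ≤ n ∸ dim G conn ∸ 1) × (2 * k ≤ n ∸ 1)
theorem8 n G conn k refl 0<k =
  let R , basis = metricBasis-exists G conn
  in  k<∣∁p∣⇒bounds R (proj₂ basis) (numBasisForced≤∣basis∣ G conn basis)
                    (numBasisForced<∣∁basis∣ G conn basis 0<k)
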